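{- For any $n \geq 0$, the set of twin Tamari diagrams of size $n$ is in bijection with the set of pairs of twin binary trees with $n$ nodes. Moreover, this bijection is expressed as follows: if $J = (T_L, T_R)$ is a pair of twin binary trees, the twin Tamari diagram in bijection with $J$ is $\mathrm{ttd}(J) := (\mathrm{td}(T_L), \mathrm{td}(T_R))$.
   Context: A binary tree is either a leaf (empty tree) or a node with a left and a right binary subtree. The inorder traversal visits recursively the left subtree, then the root, then the right subtree. The canopy of a binary tree with $n$ nodes is the word of length $n-1$ on $\{0,1\}$ obtained by reading its leaves from left to right except the first and the last one, writing $0$ if the leaf is a right child and $1$ if it is a left child. A pair of twin binary trees (with $n$ nodes) is a pair $(T_L,T_R)$ of binary trees with $n$ nodes each whose canopies differ at every position $1 \leq i \leq n-1$. The Tamari diagram $\mathrm{td}(T)$ of a binary tree $T$ with $n$ nodes is the word of length $n$ whose $i$-th letter is the number of nodes in the right subtree of the $i$-th node of $T$ in inorder; a Tamari diagram of length $n$ is a word of this form. (The Tamari diagrams of length $n$ are exactly the words $\delta$ of nonnegative integers with $0 \leq \delta_i \leq n-i$ for $1\le i \le n$ and $\delta_{i+j} \leq \delta_i - j$ for $1\le i\le n$, $1 \leq j \leq \delta_i$, and $\mathrm{td}$ is a bijection from binary trees with $n$ nodes to them.) A twin Tamari diagram of size $n$ is a pair $(\delta^L,\delta^R)$ of Tamari diagrams of length $n$ such that for every $1 \leq i \leq n-1$, exactly one letter among $\delta^L_i$ and $\delta^R_i$ is zero. -}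

module Defs where

open import Data.Fin.Base using (Fin; toℕ)
open import Data.Fin.Patterns using (0F; 1F)
open import Data.Nat.Base using (ℕ; zero; suc; pred; _<_)
open import Data.Product.Base using (∃; _×_; _,_; proj₁)
open import Data.Sum.Base using (_⊎_)
open import Data.Tree.Binary using (Tree; leaf; node; #nodes)
open import Data.Unit.Base using (⊤)
open import Data.Vec.Base using (Vec; []; _∷_; [_]; _++_; tail; init; lookup)
open import Level using (0ℓ)
open import Relation.Binary.Bundles using (Setoid)
import Relation.Binary.Construct.On as On
open import Relation.Binary.PropositionalEquality
  using (_≡_; _≢_; refl; setoid)
open import Relation.Nullary.Negation using (¬_)

Shape : Set
Shape = Tree ⊤ ⊤

BinaryTree : ℕ → Set
BinaryTree n = ∃ λ (t : Shape) → #nodes t ≡ n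

-- One letter per leaf, from left to right: 1 for a left child, 0 for a right
-- child.  The first argument is the letter given to the tree itself in case
-- it is a leaf.
leafWord : Fin 2 → (t : Shape) → Vec (Fin 2) (suc (#nodes t))
leafWord b (leaf _)     = [ b ]
leafWord b (node l _ r) = leafWord 1F l ++ leafWord 0F r

-- Removes the first and the last letter; the result is empty if there are
-- fewer than three letters.
interior : ∀ {A : Set} {n} → Vec A (suc n) → Vec A (pred n)
interior {n = zero}  _  = []
interior {n = suc _} xs = init (tail xs)

-- The letter passed to leafWord only matters for the tree with no nodes,
-- whose unique leaf is nobody's child; interior discards it.
canopy : ∀ {n} → BinaryTree n → Vec (Fin 2) (pred n)
canopy (t , refl) = interior (leafWord 0F t)

AreTwins : ∀ {n} → BinaryTree n × BinaryTree n → Set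
AreTwins {n} (TL , TR) =
  ∀ (i : Fin (pred n)) → lookup (canopy TL) i ≢ lookup (canopy TR) i

-- Sizes of the right subtrees of the nodes, the nodes being read in inorder.
rightSizes : (t : Shape) → Vec ℕ (#nodes t)
rightSizes (leaf _)     = []
rightSizes (node l _ r) = rightSizes l ++ #nodes r ∷ rightSizes r

td : ∀ {n} → BinaryTree n → Vec ℕ n
td (t , refl) = rightSizes t

IsTamariDiagram : ∀ {n} → Vec ℕ n → Set
IsTamariDiagram {n} δ = ∃ λ (T : BinaryTree n) → td T ≡ δ

ExactlyOne : Set → Set → Set
ExactlyOne P Q = (P × ¬ Q) ⊎ (¬ P × Q)

-- The 1-based position of i is suc (toℕ i), so the bound excludes exactly the
-- last letter.
IsTwinTamariDiagram : ∀ {n} → Vec ℕ n × Vec ℕ n → Set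
IsTwinTamariDiagram {n} (δL , δR) =
  IsTamariDiagram δL × IsTamariDiagram δR ×
  (∀ (i : Fin n) → suc (toℕ i) < n →
     ExactlyOne (lookup δL i ≡ 0) (lookup δR i ≡ 0))

ttd : ∀ {n} → BinaryTree n × BinaryTree n → Vec ℕ n × Vec ℕ n
ttd (TL , TR) = td TL , td TR

-- Both sets are subsets of sets of pairs: equality ignores the membership
-- proofs.
TwinBinaryTrees : ℕ → Setoid 0ℓ 0ℓ
TwinBinaryTrees n =
  On.setoid (setoid (BinaryTree n × BinaryTree n)) (proj₁ {B = AreTwins})

TwinTamariDiagrams : ℕ → Setoid 0ℓ 0ℓ
TwinTamariDiagrams n =
  On.setoid (setoid (Vec ℕ n × Vec ℕ n)) (proj₁ {B = IsTwinTamariDiagram})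

{-# OPTIONS --safe #-}

-- A leaf strictly between the i-th and the (i+1)-st node in inorder is the right
-- child of the former or the left child of the latter, and it is the right child
-- exactly when the i-th right subtree is empty.  So the i-th canopy letter is 0
-- iff the i-th letter of td is 0, which makes the two twin conditions
-- equivalent.  A tree is recovered from td by reading the letters from right to
-- left: a letter d adds a new leftmost node whose right subtree is the part of
-- the left spine that has d nodes.
module Submission where

open import Defs
open import Data.Fin.Base using (Fin; zero; suc; inject₁; lower₁)
open import Data.Fin.Patterns using (0F; 1F)
open import Data.Fin.Properties using (inject₁-lower₁; inject₁ℕ<)
open import Data.Nat.Base using (ℕ; zero; suc; _≤_; z<s; s<s; s<s⁻¹)
open import Data.Nat.Properties
  using (_≟_; ≡-irrelevant; +-suc; <⇒≢; >⇒≢; ≤-refl; ≤-trans; ≤-<-trans; m≤m+n; m<m+n)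
open import Data.Product.Base using (Σ; ∃; _×_; _,_; proj₁; proj₂)
open import Data.Sum.Base using (inj₁; inj₂)
open import Data.Tree.Binary using (leaf; node; #nodes)
open import Data.Unit.Base using (tt)
open import Data.Vec.Base using (Vec; []; _∷_; _++_; map; init; lookup; foldr′)
open import Data.Vec.Properties using (map-++; foldr-++; lookup-map)
open import Function.Bundles using (Bijection)
open import Relation.Binary.Bundles using (Setoid)
open import Relation.Binary.PropositionalEquality
  using (_≡_; _≢_; refl; sym; trans; cong; cong₂; subst; subst₂; module ≡-Reasoning)
open import Relation.Nullary.Decidable using (yes; no)
open import Relation.Nullary.Negation using (contradiction)

open ≡-Reasoning

signum : ℕ → Fin 2
signum zero    = 0F
signum (suc _) = 1F

-- The first letter is the one of the leftmost leaf: it is 1, unless the tree is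
-- itself a leaf that is a right child.
mutual
  leafWord-1F : ∀ t → leafWord 1F t ≡ 1F ∷ map signum (rightSizes t)
  leafWord-1F (leaf _)     = refl
  leafWord-1F (node l _ r) = leafWord-node l r

  leafWord-0F : ∀ t → leafWord 0F t ≡ signum (#nodes t) ∷ map signum (rightSizes t)
  leafWord-0F (leaf _)     = refl
  leafWord-0F (node l x r) = trans (leafWord-node l r)
    (cong (λ m → signum m ∷ map signum (rightSizes (node l x r)))
      -- The size of a node is `#nodes l + suc (#nodes r)`; `signum` computes to `1F` only once the
      -- successor is in front.
      (sym (+-suc (#nodes l) (#nodes r))))

  leafWord-node : ∀ l r →
    leafWord 1F l ++ leafWord 0F r ≡ 1F ∷ map signum (rightSizes (node l tt r))
  leafWord-node l r = begin
    leafWord 1F l ++ leafWord 0F r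
      ≡⟨ cong₂ _++_ (leafWord-1F l) (leafWord-0F r) ⟩
    1F ∷ map signum (rightSizes l) ++ map signum (#nodes r ∷ rightSizes r)
      ≡⟨ cong (1F ∷_) (map-++ signum (rightSizes l) (#nodes r ∷ rightSizes r)) ⟨
    1F ∷ map signum (rightSizes (node l tt r)) ∎

-- The head `0F` is a placeholder: `interior` discards it, just as it discards the letter of the
-- leftmost leaf.
canopy-td : ∀ {n} (T : BinaryTree n) → canopy T ≡ interior (0F ∷ map signum (td T))
canopy-td (t , refl) with #nodes t | leafWord 0F t | rightSizes t | leafWord-0F t
... | zero  | _ | _ | _    = refl
... | suc _ | _ | _ | refl = refl

lookup-init : ∀ {A : Set} {n} (xs : Vec A (suc n)) i →
  lookup (init xs) i ≡ lookup xs (inject₁ i)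
lookup-init (_ ∷ _ ∷ _)  zero    = refl
lookup-init (_ ∷ y ∷ xs) (suc i) = lookup-init (y ∷ xs) i

-- `inject₁` leaves out the last node: its letter belongs to the rightmost leaf, which the canopy
-- omits.
lookup-canopy : ∀ {n} (T : BinaryTree (suc n)) i →
  lookup (canopy T) i ≡ signum (lookup (td T) (inject₁ i))
lookup-canopy T i = begin
  lookup (canopy T) i                   ≡⟨ cong (λ w → lookup w i) (canopy-td T) ⟩
  lookup (init (map signum (td T))) i   ≡⟨ lookup-init (map signum (td T)) i ⟩
  lookup (map signum (td T)) (inject₁ i) ≡⟨ lookup-map (inject₁ i) signum (td T) ⟩
  signum (lookup (td T) (inject₁ i))    ∎

signum-≢⇒exactlyOne : ∀ a b → signum a ≢ signum b → ExactlyOne (a ≡ 0) (b ≡ 0)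
signum-≢⇒exactlyOne zero    zero    a≢b = contradiction refl a≢b
signum-≢⇒exactlyOne zero    (suc _) _   = inj₁ (refl , λ ())
signum-≢⇒exactlyOne (suc _) zero    _   = inj₂ ((λ ()) , refl)
signum-≢⇒exactlyOne (suc _) (suc _) a≢b = contradiction refl a≢b

exactlyOne⇒signum-≢ : ∀ a b → ExactlyOne (a ≡ 0) (b ≡ 0) → signum a ≢ signum b
exactlyOne⇒signum-≢ zero    zero    (inj₁ (_ , b≢0)) _ = b≢0 refl
exactlyOne⇒signum-≢ zero    zero    (inj₂ (a≢0 , _)) _ = a≢0 refl
exactlyOne⇒signum-≢ (suc _) (suc _) (inj₁ (() , _))
exactlyOne⇒signum-≢ (suc _) (suc _) (inj₂ (_ , ()))

areTwins⇒isTwinTamariDiagram : ∀ {n} (J : BinaryTree n × BinaryTree n) →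
  AreTwins J → IsTwinTamariDiagram (ttd J)
areTwins⇒isTwinTamariDiagram {zero}  (TL , TR) _ = (TL , refl) , (TR , refl) , λ ()
areTwins⇒isTwinTamariDiagram {suc n} (TL , TR) twins =
  (TL , refl) , (TR , refl) , λ i i<n →
    -- Since `i` is not the last position, it lowers to a position of the canopy, which is one
    -- letter shorter.
    let n≢i = >⇒≢ (s<s⁻¹ i<n) in
    subst Separated (inject₁-lower₁ i n≢i) (separated (lower₁ i n≢i))
  where
  Separated : Fin (suc n) → Set
  Separated i = ExactlyOne (lookup (td TL) i ≡ 0) (lookup (td TR) i ≡ 0)

  separated : ∀ j → Separated (inject₁ j)
  separated j = signum-≢⇒exactlyOne _ _
    (subst₂ _≢_ (lookup-canopy TL j) (lookup-canopy TR j) (twins j))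

isTwinTamariDiagram⇒areTwins : ∀ {n} (J : BinaryTree n × BinaryTree n) →
  IsTwinTamariDiagram (ttd J) → AreTwins J
isTwinTamariDiagram⇒areTwins {suc n} (TL , TR) (_ , _ , separated) i =
  subst₂ _≢_ (sym (lookup-canopy TL i)) (sym (lookup-canopy TR i))
    (exactlyOne⇒signum-≢ _ _ (separated (inject₁ i) (s<s (inject₁ℕ< i))))

-- The leaf clause is the intended result for `d` = 0 and a default value when no subtree on the
-- left spine has `d` nodes.
insert : ℕ → Shape → Shape
insert d (leaf _) = node (leaf tt) tt (leaf tt)
insert d t@(node l _ r) with d ≟ #nodes t
... | yes _ = node (leaf tt) tt t
... | no  _ = node (insert d l) tt r

fromSizes : ∀ {n} → Vec ℕ n → Shape
fromSizes = foldr′ insert (leaf tt)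

-- In inorder the nodes of `t` precede those of `u`: reading from right to left, `u` is what has
-- been built before `t`.
graftLeftmost : Shape → Shape → Shape
graftLeftmost (leaf _)     t = t
graftLeftmost (node l _ r) t = node (graftLeftmost l t) tt r

#nodes-graftLeftmost : ∀ u t → #nodes t ≤ #nodes (graftLeftmost u t)
#nodes-graftLeftmost (leaf _)     t = ≤-refl
#nodes-graftLeftmost (node u _ v) t =
  ≤-trans (#nodes-graftLeftmost u t) (m≤m+n _ (suc (#nodes v)))

-- Sizes strictly decrease down the left spine, so the search made by `insert` passes all spine
-- nodes of `u` and stops exactly at `r`.
insert-graftLeftmost : ∀ u r →
  insert (#nodes r) (graftLeftmost u r) ≡ graftLeftmost u (node (leaf tt) tt r)
insert-graftLeftmost (leaf _) (leaf _) = refl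
insert-graftLeftmost (leaf _) r@(node _ _ _) with #nodes r ≟ #nodes r
... | yes _   = refl
... | no  r≢r = contradiction refl r≢r
insert-graftLeftmost (node u _ v) r with #nodes r ≟ #nodes (graftLeftmost (node u tt v) r)
-- Besides `r`, this spine subtree contains at least its own root, so the sizes cannot agree.
... | yes eq = contradiction eq (<⇒≢ (≤-<-trans (#nodes-graftLeftmost u r) (m<m+n _ z<s)))
... | no  _  = cong (λ l → node l tt v) (insert-graftLeftmost u r)

-- The left leaf of the newly inserted root is the leftmost leaf of the whole tree, so `l` lands as
-- the left subtree of that root.
graftLeftmost-node : ∀ u l r →
  graftLeftmost (graftLeftmost u (node (leaf tt) tt r)) l ≡ graftLeftmost u (node l tt r)
graftLeftmost-node (leaf _)     l r = refl
graftLeftmost-node (node u _ v) l r = cong (λ l → node l tt v) (graftLeftmost-node u l r)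

graftLeftmost-leaf : ∀ u → graftLeftmost u (leaf tt) ≡ u
graftLeftmost-leaf (leaf _)     = refl
graftLeftmost-leaf (node u _ v) = cong (λ l → node l tt v) (graftLeftmost-leaf u)

-- Generalised from u = leaf tt so that the induction can pass to the left
-- subtree once the root has been inserted.
foldr-insert-rightSizes : ∀ u t → foldr′ insert u (rightSizes t) ≡ graftLeftmost u t
foldr-insert-rightSizes u (leaf _)     = sym (graftLeftmost-leaf u)
foldr-insert-rightSizes u (node l _ r) = begin
  foldr′ insert u (rightSizes l ++ #nodes r ∷ rightSizes r)
    ≡⟨ foldr-++ _ insert (rightSizes l) ⟩
  foldr′ insert (insert (#nodes r) (foldr′ insert u (rightSizes r))) (rightSizes l)
    ≡⟨ cong (λ t → foldr′ insert (insert (#nodes r) t) (rightSizes l))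
         (foldr-insert-rightSizes u r) ⟩
  foldr′ insert (insert (#nodes r) (graftLeftmost u r)) (rightSizes l)
    ≡⟨ cong (λ t → foldr′ insert t (rightSizes l)) (insert-graftLeftmost u r) ⟩
  foldr′ insert (graftLeftmost u (node (leaf tt) tt r)) (rightSizes l)
    ≡⟨ foldr-insert-rightSizes (graftLeftmost u (node (leaf tt) tt r)) l ⟩
  graftLeftmost (graftLeftmost u (node (leaf tt) tt r)) l
    ≡⟨ graftLeftmost-node u l r ⟩
  graftLeftmost u (node l tt r) ∎

fromSizes-td : ∀ {n} (T : BinaryTree n) → fromSizes (td T) ≡ proj₁ T
fromSizes-td (t , refl) = foldr-insert-rightSizes (leaf tt) t

-- `fromSizes` recovers the shape from `td`, and any two proofs of the size equation coincide.
td-injective : ∀ {n} {T U : BinaryTree n} → td T ≡ td U → T ≡ U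
td-injective {T = T@(t , p)} {U = U@(u , q)} eq
  with refl ← trans (sym (fromSizes-td T)) (trans (cong fromSizes eq) (fromSizes-td U))
  = cong (t ,_) (≡-irrelevant p q)

ttd-injective : ∀ {n} {J K : BinaryTree n × BinaryTree n} → ttd J ≡ ttd K → J ≡ K
ttd-injective eq =
  cong₂ _,_ (td-injective (cong proj₁ eq)) (td-injective (cong proj₂ eq))

ttd-surjective : ∀ {n} (δ : Vec ℕ n × Vec ℕ n) → IsTwinTamariDiagram δ →
  ∃ λ (J : BinaryTree n × BinaryTree n) → AreTwins J × ttd J ≡ δ
-- Being a Tamari diagram already provides the tree, so only the twin condition has to be
-- transferred.
ttd-surjective _ isTwin@((TL , refl) , (TR , refl) , _) =
  (TL , TR) , isTwinTamariDiagram⇒areTwins (TL , TR) isTwin , refl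

proposition5p3 : ∀ (n : ℕ) →
    Σ (Bijection (TwinBinaryTrees n) (TwinTamariDiagrams n)) λ φ →
      ∀ (J : Setoid.Carrier (TwinBinaryTrees n)) →
        proj₁ (Bijection.to φ J) ≡ ttd (proj₁ J)
proposition5p3 n = record
  { to        = λ (J , twins) → ttd J , areTwins⇒isTwinTamariDiagram J twins
  ; cong      = cong ttd
  ; bijective = ttd-injective , λ (δ , isTwin) →
      -- Surjectivity between setoids concerns every `K` equal to the chosen `J`, hence the extra
      -- `cong ttd`.
      let J , twins , ttdJ≡δ = ttd-surjective δ isTwin in
      (J , twins) , λ K≡J → trans (cong ttd K≡J) ttdJ≡δ
  } , λ _ → refl
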